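{- For every tree $T$ of order $n\ge 2$ that is not isomorphic to the star $K_{1,n-1}$, $\gamma_{rdR}(T)\ge n+2$.
   Context: All graphs are finite and simple. An RDRD function of $G$ is a function $f:V(G)\to\{0,1,2,3\}$ such that every vertex with value $0$ has at least two neighbors with value $2$ or at least one neighbor with value $3$, every vertex with value $1$ has a neighbor with value $2$ or $3$, and the subgraph induced by the vertices with value $0$ has no isolated vertices; $\gamma_{rdR}(G)$ is the minimum of $\sum_v f(v)$ over RDRD functions. -}

module Defs where

open import Data.Nat.Base using (ℕ; _+_; _^_; _≤_; _<_)
open import Data.Nat.Properties using (+-0-monoid; _≤?_; _<?_; <⇒≱; ≤-trans; ≤-reflexive)
open import Data.Fin.Base using (Fin; toℕ; finToFun; funToFin)
open import Data.Fin.Patterns using (0F; 1F; 2F; 3F)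
open import Data.Fin.Properties using (_≟_; all?; any?; finToFun-funToFin)
open import Data.List.Base using (List; _∷_; _∷ʳ_; length; map; filter; allFin)
open import Data.List.Extrema.Nat using (min; argmin-sel; min≤xs)
open import Data.List.Membership.Propositional using (_∈_)
open import Data.List.Membership.Propositional.Properties
  using (∈-map⁺; ∈-map⁻; ∈-filter⁺; ∈-filter⁻; ∈-allFin)
open import Data.List.Relation.Unary.All using () renaming (lookup to All-lookup)
open import Data.List.Relation.Unary.Linked using (Linked)
open import Data.List.Relation.Unary.Unique.Propositional using (Unique)
open import Data.Product.Base using (_×_; _,_; ∃-syntax; swap; proj₂)
open import Data.Sum.Base using (_⊎_; inj₁; inj₂) renaming (swap to ⊎-swap; map to ⊎-map)
open import Function.Base using (id; const; _∘_)
open import Function.Bundles using (_↔_; _⇔_; module Inverse)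
open import Level using (0ℓ)
open import Relation.Binary.Core using (Rel)
open import Relation.Binary.Definitions using (Decidable; Symmetric)
open import Relation.Binary.Construct.Closure.ReflexiveTransitive using (Star)
open import Relation.Binary.PropositionalEquality
  using (_≡_; _≢_; _≗_; refl; sym; trans; cong)
open import Relation.Nullary using (¬_; Dec)
open import Relation.Nullary.Decidable using (_×-dec_; _⊎-dec_; _→-dec_; ¬?; map′)

open import Algebra.Properties.Monoid.Sum +-0-monoid using (sum; sum-cong-≗)

-- A finite simple graph of order n, with vertex set Fin n.
record Graph (n : ℕ) : Set₁ where
  field
    Adj    : Rel (Fin n) 0ℓ
    adj?   : Decidable Adj
    symm   : Symmetric Adj
    irrefl : ∀ {v} → ¬ Adj v v

open Graph public

record _≅_ {m n} (G : Graph m) (H : Graph n) : Set where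
  field
    bijection : Fin m ↔ Fin n
    preserves : ∀ u v → Adj G u v ⇔ Adj H (Inverse.to bijection u) (Inverse.to bijection v)

-- The complete bipartite graph K_{p,q}; the parts are {0,…,p-1} and {p,…,p+q-1}.
K : (p q : ℕ) → Graph (p + q)
K p q = record
  { Adj    = λ u v → (toℕ u < p × p ≤ toℕ v) ⊎ (p ≤ toℕ u × toℕ v < p)
  ; adj?   = λ u v → ((toℕ u <? p) ×-dec (p ≤? toℕ v)) ⊎-dec ((p ≤? toℕ u) ×-dec (toℕ v <? p))
  ; symm   = λ a → ⊎-swap (⊎-map swap swap a)
  ; irrefl = λ { (inj₁ (v<p , p≤v)) → <⇒≱ v<p p≤v ; (inj₂ (p≤v , v<p)) → <⇒≱ v<p p≤v }
  }

module _ {n : ℕ} (G : Graph n) where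

  Connected : Set
  Connected = ∀ u v → Star (Adj G) u v

  -- The vertex v followed by vs lists the at least three distinct vertices of
  -- a cycle in cyclic order; v is repeated at the end to close it up.
  IsCycle : Fin n → List (Fin n) → Set
  IsCycle v vs = 2 ≤ length vs × Unique (v ∷ vs) × Linked (Adj G) (v ∷ (vs ∷ʳ v))

  Acyclic : Set
  Acyclic = ∀ v vs → ¬ IsCycle v vs

  IsTree : Set
  IsTree = Connected × Acyclic

  record IsRDRD (f : Fin n → Fin 4) : Set where
    constructor mkRDRD
    field
      zero-dominated : ∀ v → f v ≡ 0F →
        (∃[ u ] ∃[ w ] (u ≢ w × (Adj G v u × f u ≡ 2F) × (Adj G v w × f w ≡ 2F)))
        ⊎ (∃[ u ] (Adj G v u × f u ≡ 3F))
      one-dominated  : ∀ v → f v ≡ 1F → ∃[ u ] (Adj G v u × (f u ≡ 2F ⊎ f u ≡ 3F))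
      restrained     : ∀ v → f v ≡ 0F → ∃[ u ] (Adj G v u × f u ≡ 0F)

  isRDRD? : (f : Fin n → Fin 4) → Dec (IsRDRD f)
  isRDRD? f = map′ (λ { (a , b , c) → mkRDRD a b c }) (λ { (mkRDRD a b c) → a , b , c })
    (all? (λ v → (f v ≟ 0F) →-dec
        (any? (λ u → any? (λ w → ¬? (u ≟ w) ×-dec
           ((adj? G v u ×-dec (f u ≟ 2F)) ×-dec (adj? G v w ×-dec (f w ≟ 2F)))))
         ⊎-dec any? (λ u → adj? G v u ×-dec (f u ≟ 3F))))
     ×-dec all? (λ v → (f v ≟ 1F) →-dec
        any? (λ u → adj? G v u ×-dec ((f u ≟ 2F) ⊎-dec (f u ≟ 3F))))
     ×-dec all? (λ v → (f v ≟ 0F) →-dec any? (λ u → adj? G v u ×-dec (f u ≟ 0F))))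

weight : ∀ {n} → (Fin n → Fin 4) → ℕ
weight f = sum (λ v → toℕ (f v))

module _ {n : ℕ} (G : Graph n) where

  -- finToFun enumerates all functions Fin n → Fin 4, up to pointwise equality.
  RDRDs : List (Fin n → Fin 4)
  RDRDs = filter (isRDRD? G) (map finToFun (allFin (4 ^ n)))

  -- The minimum of a list needs a starting value; the constant function 2 is
  -- always an RDRD function, so its weight does not affect the minimum.  See
  -- γrdR-attained and γrdR-minimal.
  γrdR : ℕ
  γrdR = min (weight {n} (const 2F)) (map weight RDRDs)

  const2-RDRD : IsRDRD G (const 2F)
  const2-RDRD = mkRDRD (λ _ ()) (λ _ ()) (λ _ ())

  RDRD-resp-≗ : ∀ {f g} → f ≗ g → IsRDRD G f → IsRDRD G g
  RDRD-resp-≗ {f} {g} f≗g (mkRDRD a b c) = mkRDRD a′ b′ c′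
    where
    to : ∀ {v x} → f v ≡ x → g v ≡ x
    to = trans (sym (f≗g _))
    a′ : ∀ v → g v ≡ 0F →
        (∃[ u ] ∃[ w ] (u ≢ w × (Adj G v u × g u ≡ 2F) × (Adj G v w × g w ≡ 2F)))
        ⊎ (∃[ u ] (Adj G v u × g u ≡ 3F))
    a′ v e with a v (trans (f≗g v) e)
    ... | inj₁ (u , w , u≢w , (p , q) , (r , s)) = inj₁ (u , w , u≢w , (p , to q) , (r , to s))
    ... | inj₂ (u , p , q) = inj₂ (u , p , to q)
    b′ : ∀ v → g v ≡ 1F → ∃[ u ] (Adj G v u × (g u ≡ 2F ⊎ g u ≡ 3F))
    b′ v e with b v (trans (f≗g v) e)
    ... | u , p , q = u , p , ⊎-map to to q
    c′ : ∀ v → g v ≡ 0F → ∃[ u ] (Adj G v u × g u ≡ 0F)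
    c′ v e with c v (trans (f≗g v) e)
    ... | u , p , q = u , p , to q

  γrdR-attained : ∃[ f ] (IsRDRD G f × weight f ≡ γrdR)
  γrdR-attained with argmin-sel id (weight {n} (const 2F)) (map weight RDRDs)
  ... | inj₁ e = const 2F , const2-RDRD , sym e
  ... | inj₂ γ∈ with ∈-map⁻ weight γ∈
  ...   | f , f∈ , e = f , proj₂ (∈-filter⁻ (isRDRD? G) {xs = map finToFun (allFin (4 ^ n))} f∈) , sym e

  γrdR-minimal : ∀ f → IsRDRD G f → γrdR ≤ weight f
  γrdR-minimal f rf = ≤-trans
    (All-lookup (min≤xs (weight {n} (const 2F)) (map weight RDRDs)) (∈-map⁺ weight g∈))
    (≤-reflexive (sum-cong-≗ (cong toℕ ∘ g≗f)))
    where
    g : Fin n → Fin 4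
    g = finToFun (funToFin f)
    g≗f : g ≗ f
    g≗f = finToFun-funToFin f
    g∈ : g ∈ RDRDs
    g∈ = ∈-filter⁺ (isRDRD? G) (∈-map⁺ finToFun (∈-allFin (funToFin f)))
           (RDRD-resp-≗ (sym ∘ g≗f) rf)

{-# OPTIONS --safe #-}

-- Let Vᵢ be the set of vertices of value i.  If V₀ is empty, then the weight exceeds the
-- order by |V₂| + 2|V₃|, and this is at most 1 only when a single vertex of value 2
-- dominates all others, which makes the tree a star.  Otherwise V₀ ∪ V₃ and V₀ ∪ V₂ ∪ V₃
-- both induce nonempty forests, and a forest has fewer edges than vertices.  Adding the
-- two bounds, every vertex of V₀ has a neighbour in V₀ (an edge counted in both forests)
-- and either one neighbour in V₃ (counted in both) or two in V₂ (counted in the second),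
-- which gives |V₀| + 2 ≤ |V₂| + 2|V₃|.

module Submission where

open import Defs
open import Data.Bool.Base using (if_then_else_)
open import Data.Fin.Base using (Fin; zero; suc; toℕ)
open import Data.Fin.Patterns using (0F; 1F; 2F; 3F)
open import Data.Fin.Permutation using (Permutation; transpose)
open import Data.Fin.Properties using (_≟_; any?; all?; toℕ-injective)
open import Data.List.Base using (List; []; _∷_; _++_; _∷ʳ_; length; map)
open import Data.List.Membership.Propositional using (_∉_)
open import Data.List.Membership.Propositional.Properties using (∈-∃++)
open import Data.List.Properties using (map-cong-local)
open import Data.List.Relation.Unary.All as All using ([]; _∷_)
open import Data.List.Relation.Unary.All.Properties using (++⁻ˡ; ++⁻ʳ; ¬Any⇒All¬)
open import Data.List.Relation.Unary.AllPairs using ([]; _∷_)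
open import Data.List.Relation.Unary.Linked using (Linked; [-]; _∷_)
open import Data.List.Relation.Unary.Unique.Propositional using (Unique)
open import Data.Nat.Base using (ℕ; zero; suc; _+_; _*_; _∸_; _⊓_; _≤_; _<_; z≤n; s≤s)
open import Data.Nat.ListAction using () renaming (sum to sumᴸ)
open import Data.Nat.Properties renaming (_≟_ to _≟ℕ_)
open import Data.Nat.Tactic.RingSolver using (solve-∀)
open import Data.Product.Base using (_×_; _,_; ∃-syntax)
open import Data.Sum.Base using (_⊎_; inj₁; inj₂)
open import Data.Vec.Functional using (updateAt)
open import Data.Vec.Functional.Properties using (updateAt-minimal)
open import Function.Base using (_∘_; const)
open import Function.Bundles using (mk⇔; module Inverse)
open import Level using (0ℓ)
open import Relation.Binary.Core using (Rel)
open import Relation.Binary.PropositionalEquality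
  using (_≡_; _≢_; _≗_; refl; sym; trans; cong; cong₂; subst; module ≡-Reasoning)
open import Relation.Nullary using (¬_; Dec; yes; no; does; contradiction)
open import Relation.Nullary.Decidable using (_×-dec_; _⊎-dec_; _→-dec_; ¬?; dec-true; dec-false)
open import Relation.Unary using (Pred; Decidable)

open import Algebra.Properties.Semiring.Sum +-*-semiring
  using (sum; sum-cong-≗; sum-replicate-zero; ∑-distrib-+; ∑-comm; *-distribˡ-sum)

private variable
  n : ℕ

-- Sums over Fin n

sum-mono : {g h : Fin n → ℕ} → (∀ v → g v ≤ h v) → sum g ≤ sum h
sum-mono {zero}  g≤h = z≤n
sum-mono {suc n} g≤h = +-mono-≤ (g≤h 0F) (sum-mono (g≤h ∘ suc))

sum-const : ∀ n k → sum {n} (const k) ≡ n * k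
sum-const zero    k = refl
sum-const (suc n) k = cong (k +_) (sum-const n k)

sum-erase : ∀ x (g : Fin n → ℕ) → sum g ≡ g x + sum (updateAt g x (const 0))
sum-erase zero    g = refl
sum-erase (suc x) g = trans (cong (g 0F +_) (sum-erase x (g ∘ suc)))
  (swap (g 0F) (g (suc x)) _)
  where
  swap : ∀ a b c → a + (b + c) ≡ b + (a + c)
  swap = solve-∀

-- Induction on the list: setting `g` to 0 at the head takes its share out of the sum and leaves the
-- values on the tail alone, since the head does not recur there.
unique-sum≤ : ∀ {xs} → Unique xs → (g : Fin n → ℕ) → sumᴸ (map g xs) ≤ sum g
unique-sum≤ []       g = z≤n
unique-sum≤ {xs = x ∷ xs} (x∉ ∷ u) g = begin
  g x + sumᴸ (map g xs)   ≡⟨ cong (λ l → g x + sumᴸ l) (map-cong-local (All.map g≡g′ x∉)) ⟩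
  g x + sumᴸ (map g′ xs)  ≤⟨ +-monoʳ-≤ (g x) (unique-sum≤ u g′) ⟩
  g x + sum g′            ≡⟨ sum-erase x g ⟨
  sum g                   ∎
  where
  open ≤-Reasoning
  g′ : Fin _ → ℕ
  g′ = updateAt g x (const 0)
  g≡g′ : ∀ {y} → x ≢ y → g y ≡ g′ y
  g≡g′ {y} x≢y = sym (updateAt-minimal y x g (x≢y ∘ sym))

unique-length≤ : {xs : List (Fin n)} → Unique xs → length xs ≤ n
unique-length≤ {n} {xs} u = begin
  length xs                ≡⟨ length-sum xs ⟩
  sumᴸ (map (const 1) xs)  ≤⟨ unique-sum≤ u (const 1) ⟩
  sum {n} (const 1)        ≡⟨ sum-const n 1 ⟩
  n * 1                    ≡⟨ *-identityʳ n ⟩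
  n                        ∎
  where
  open ≤-Reasoning
  length-sum : (ys : List (Fin n)) → length ys ≡ sumᴸ (map (const 1) ys)
  length-sum []       = refl
  length-sum (_ ∷ ys) = cong suc (length-sum ys)

-- Vertex sets are encoded by indicator functions into ℕ, so that cardinalities and edge counts
-- become sums; this one encodes a singleton.
δ : Fin n → Fin n → ℕ
δ v w = if does (v ≟ w) then 1 else 0

sum-δ : ∀ v (g : Fin n → ℕ) → sum (λ w → δ v w * g w) ≡ g v
sum-δ {suc n} zero    g =
  trans (cong₂ _+_ (*-identityˡ (g 0F)) (sum-replicate-zero n)) (+-identityʳ (g 0F))
sum-δ {suc n} (suc v) g = sum-δ v (g ∘ suc)

sum-δ≡1 : ∀ (v : Fin n) → sum (δ v) ≡ 1
sum-δ≡1 v = trans (sum-cong-≗ (λ w → sym (*-identityʳ (δ v w)))) (sum-δ v (const 1))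

δ≤ : {g : Fin n → ℕ} → ∀ v → 1 ≤ g v → ∀ w → δ v w ≤ g w
δ≤ v 1≤gv w with v ≟ w
... | yes refl = 1≤gv
... | no _     = z≤n

≤δ : {g : Fin n → ℕ} → ∀ v → g v ≤ 1 → (∀ w → w ≢ v → g w ≡ 0) → ∀ w → g w ≤ δ v w
≤δ v gv≤1 g≡0 w with v ≟ w
... | yes refl = gv≤1
... | no v≢w   = ≤-reflexive (g≡0 w (v≢w ∘ sym))

-- Leaves of induced forests

-- Together with `linked-prefix` this cuts a path at `w`. Here `w` moves to the front, as the base
-- vertex of a future cycle; there it stays at the end, where it closes that cycle.
unique-prefix : ∀ {A : Set} {w : A} ys {zs} → Unique (ys ++ w ∷ zs) → Unique (w ∷ ys)
unique-prefix []       _        = [] ∷ []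
unique-prefix (y ∷ ys) (y∉ ∷ u) with unique-prefix ys u | ++⁻ʳ ys y∉
... | w∉ys ∷ uys | y≢w ∷ _ = ((y≢w ∘ sym) ∷ w∉ys) ∷ ++⁻ˡ ys y∉ ∷ uys

linked-prefix : ∀ {A : Set} {R : Rel A 0ℓ} {w} ys {zs} →
                Linked R (ys ++ w ∷ zs) → Linked R (ys ∷ʳ w)
linked-prefix []           _       = [-]
linked-prefix (y ∷ [])     (r ∷ _) = r ∷ [-]
linked-prefix (y ∷ z ∷ ys) (r ∷ l) = r ∷ linked-prefix (z ∷ ys) l

module _ (G : Graph n) (acyclic : Acyclic G) where

  -- Paths grow at the head, so the vertex before `v` is the head of `vs`. The default `v` is
  -- harmless, because a neighbour of `v` always differs from `v`.
  predecessor : Fin n → List (Fin n) → Fin n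
  predecessor v []      = v
  predecessor v (p ∷ _) = p

  -- If `w` were `v`, there would be a loop; if it came second, it would be the predecessor; if it
  -- came later, the path from `v` up to `w` and the edge back to `v` would form a cycle.
  path-avoids : ∀ {v vs w} → Unique (v ∷ vs) → Linked (Adj G) (v ∷ vs) →
                Adj G v w → w ≢ predecessor v vs → w ∉ v ∷ vs
  path-avoids u l vw w≢p w∈ with ∈-∃++ w∈
  ... | []          , zs , refl = irrefl G vw
  ... | y ∷ []      , zs , refl = w≢p refl
  ... | y ∷ z ∷ ys  , zs , refl = acyclic _ (y ∷ z ∷ ys)
    (s≤s (s≤s z≤n) , unique-prefix (y ∷ z ∷ ys) u , symm G vw ∷ linked-prefix (y ∷ z ∷ ys) l)

  module _ {S : Pred (Fin n) 0ℓ} (S? : Decidable S) where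

    -- The vertex `p` need not be adjacent to `v`, so isolated vertices of the induced subgraph
    -- count as leaves too.
    IsLeaf : Fin n → Set
    IsLeaf v = S v × ∃[ p ] (∀ w → Adj G v w → S w → w ≡ p)

    leaf? : ∀ v → Dec (IsLeaf v)
    leaf? v = S? v ×-dec any? λ p → all? λ w → adj? G v w →-dec (S? w →-dec (w ≟ p))

    another-neighbour : ∀ {v} → S v → ¬ IsLeaf v → ∀ p → ∃[ w ] (Adj G v w × S w × w ≢ p)
    another-neighbour {v} Sv ¬leaf p
      with any? (λ w → adj? G v w ×-dec (S? w ×-dec ¬? (w ≟ p)))
    ... | yes found = found
    ... | no none   = contradiction (Sv , p , only-p) ¬leaf
      where
      only-p : ∀ w → Adj G v w → S w → w ≡ p
      only-p w vw Sw with w ≟ p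
      ... | yes w≡p = w≡p
      ... | no  w≢p = contradiction (w , vw , Sw , w≢p) none

    -- Without leaves a path never gets stuck: its head has a neighbour in `S` other than the
    -- predecessor, and by `path-avoids` that neighbour is new.
    long-path : ∀ {r} → S r → (∀ v → ¬ IsLeaf v) → ∀ k →
      ∃[ v ] ∃[ vs ] (S v × Unique (v ∷ vs) × Linked (Adj G) (v ∷ vs) × length vs ≡ k)
    long-path Sr ¬leaf zero = _ , [] , Sr , [] ∷ [] , [-] , refl
    long-path Sr ¬leaf (suc k)
      with v , vs , Sv , u , l , len ← long-path Sr ¬leaf k
      with w , vw , Sw , w≢p ← another-neighbour Sv (¬leaf v) (predecessor v vs)
      = w , v ∷ vs , Sw , ¬Any⇒All¬ _ (path-avoids u l vw w≢p) ∷ u , symm G vw ∷ l , cong suc len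

    leaf-exists : ∀ {r} → S r → ∃[ v ] IsLeaf v
    leaf-exists Sr with any? leaf?
    ... | yes found = found
    ... | no none
      -- Length `n` for the tail means `n + 1` distinct vertices in `Fin n`.
      with v , vs , _ , u , _ , len ← long-path Sr (λ v leaf → none (v , leaf)) n
      = contradiction (subst (λ l → suc l ≤ n) len (unique-length≤ u)) 1+n≰n

-- Counting edges

module _ (G : Graph n) where

  adj : Fin n → Fin n → ℕ
  adj u v = if does (adj? G u v) then 1 else 0

  adj-1 : ∀ {u v} → Adj G u v → adj u v ≡ 1
  adj-1 {u} {v} uv rewrite dec-true (adj? G u v) uv = refl

  adj-0 : ∀ {u v} → ¬ Adj G u v → adj u v ≡ 0
  adj-0 {u} {v} ¬uv rewrite dec-false (adj? G u v) ¬uv = refl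

  adj≤1 : ∀ u v → adj u v ≤ 1
  adj≤1 u v with adj? G u v
  ... | yes _ = ≤-refl
  ... | no _  = z≤n

  adj-sym : ∀ u v → adj u v ≡ adj v u
  adj-sym u v with adj? G u v
  ... | yes uv = sym (adj-1 (symm G uv))
  ... | no ¬uv = sym (adj-0 (¬uv ∘ symm G))

  deg : (Fin n → ℕ) → Fin n → ℕ
  deg t u = sum (λ v → adj u v * t v)

  -- For the indicator function s of a vertex set, edges s s is twice the number of edges
  -- that the set induces.
  edges : (s t : Fin n → ℕ) → ℕ
  edges s t = sum (λ u → s u * deg t u)

  deg-cong : ∀ {t t′} → t ≗ t′ → deg t ≗ deg t′
  deg-cong eq u = sum-cong-≗ (λ v → cong (adj u v *_) (eq v))

  deg-+ : ∀ t t′ u → deg (λ v → t v + t′ v) u ≡ deg t u + deg t′ u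
  deg-+ t t′ u = trans (sum-cong-≗ (λ v → *-distribˡ-+ (adj u v) (t v) (t′ v)))
    (∑-distrib-+ (λ v → adj u v * t v) (λ v → adj u v * t′ v))

  deg-mono : ∀ {t t′} → (∀ v → t v ≤ t′ v) → ∀ u → deg t u ≤ deg t′ u
  deg-mono le u = sum-mono (λ v → *-monoʳ-≤ (adj u v) (le v))

  deg≤sum : ∀ t u → deg t u ≤ sum t
  deg≤sum t u = sum-mono (λ v → subst (adj u v * t v ≤_) (*-identityˡ (t v)) (*-monoˡ-≤ (t v) (adj≤1 u v)))

  edges-cong : ∀ {s s′ t t′} → s ≗ s′ → t ≗ t′ → edges s t ≡ edges s′ t′
  edges-cong s≗ t≗ = sum-cong-≗ (λ u → cong₂ _*_ (s≗ u) (deg-cong t≗ u))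

  edges-+ˡ : ∀ s s′ t → edges (λ v → s v + s′ v) t ≡ edges s t + edges s′ t
  edges-+ˡ s s′ t = trans (sum-cong-≗ (λ u → *-distribʳ-+ (deg t u) (s u) (s′ u)))
    (∑-distrib-+ (λ u → s u * deg t u) (λ u → s′ u * deg t u))

  edges-+ʳ : ∀ s t t′ → edges s (λ v → t v + t′ v) ≡ edges s t + edges s t′
  edges-+ʳ s t t′ = trans
    (sum-cong-≗ (λ u → trans (cong (s u *_) (deg-+ t t′ u)) (*-distribˡ-+ (s u) (deg t u) (deg t′ u))))
    (∑-distrib-+ (λ u → s u * deg t u) (λ u → s u * deg t′ u))

  edges-monoʳ : ∀ s {t t′} → (∀ v → t v ≤ t′ v) → edges s t ≤ edges s t′
  edges-monoʳ s le = sum-mono (λ u → *-monoʳ-≤ (s u) (deg-mono le u))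

  edges-sym : ∀ s t → edges s t ≡ edges t s
  edges-sym s t = begin
    sum (λ u → s u * deg t u)                          ≡⟨ sum-cong-≗ (λ u → *-distribˡ-sum (s u) (λ v → adj u v * t v)) ⟩
    sum (λ u → sum (λ v → s u * (adj u v * t v)))      ≡⟨ ∑-comm (λ u v → s u * (adj u v * t v)) ⟩
    sum (λ v → sum (λ u → s u * (adj u v * t v)))      ≡⟨ sum-cong-≗ (λ v → sum-cong-≗ (λ u →
                                                            trans (cong (λ a → s u * (a * t v)) (adj-sym u v)) (swap (s u) (adj v u) (t v)))) ⟩
    sum (λ v → sum (λ u → t v * (adj v u * s u)))      ≡⟨ sum-cong-≗ (λ v → *-distribˡ-sum (t v) (λ u → adj v u * s u)) ⟨
    sum (λ v → t v * deg s v)                          ∎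
    where
    open ≡-Reasoning
    swap : ∀ a b c → a * (b * c) ≡ c * (b * a)
    swap = solve-∀

  edges-δˡ : ∀ v t → edges (δ v) t ≡ deg t v
  edges-δˡ v t = sum-δ v (deg t)

  edges-δδ : ∀ v → edges (δ v) (δ v) ≡ 0
  edges-δδ v = begin
    edges (δ v) (δ v)            ≡⟨ edges-δˡ v (δ v) ⟩
    sum (λ w → adj v w * δ v w)  ≡⟨ sum-cong-≗ (λ w → *-comm (adj v w) (δ v w)) ⟩
    sum (λ w → δ v w * adj v w)  ≡⟨ sum-δ v (adj v) ⟩
    adj v v                      ≡⟨ adj-0 (irrefl G) ⟩
    0                            ∎
    where open ≡-Reasoning

  -- Bilinear expansion: the term of `v` with itself vanishes for lack of loops, and the two mixed
  -- terms agree by symmetry.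
  edges-insert : ∀ v t → edges (λ w → δ v w + t w) (λ w → δ v w + t w) ≡ edges t t + 2 * deg t v
  edges-insert v t = begin
    edges δ+t δ+t                                                  ≡⟨ edges-+ˡ (δ v) t δ+t ⟩
    edges (δ v) δ+t + edges t δ+t                                  ≡⟨ cong₂ _+_ (edges-+ʳ (δ v) (δ v) t) (edges-+ʳ t (δ v) t) ⟩
    edges (δ v) (δ v) + edges (δ v) t + (edges t (δ v) + edges t t) ≡⟨ cong₂ (λ a b → a + edges (δ v) t + (b + edges t t)) (edges-δδ v) (edges-sym t (δ v)) ⟩
    edges (δ v) t + (edges (δ v) t + edges t t)                    ≡⟨ cong (λ a → a + (a + edges t t)) (edges-δˡ v t) ⟩
    deg t v + (deg t v + edges t t)                                ≡⟨ rearrange (deg t v) (edges t t) ⟩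
    edges t t + 2 * deg t v                                        ∎
    where
    open ≡-Reasoning
    δ+t : Fin n → ℕ
    δ+t w = δ v w + t w
    rearrange : ∀ a b → a + (a + b) ≡ b + 2 * a
    rearrange = solve-∀

  -- Pairs between `a` and `b` occur in both orders on the right, hence the doubled `b` on the left;
  -- pairs inside `b` are dropped.
  edges-sum-≥ : ∀ a b → edges a (λ v → a v + b v + b v) ≤ edges (λ v → a v + b v) (λ v → a v + b v)
  edges-sum-≥ a b = begin
    edges a (λ v → a v + b v + b v)  ≡⟨ edges-+ʳ a a+b b ⟩
    edges a a+b + edges a b          ≡⟨ cong (edges a a+b +_) (edges-sym a b) ⟩
    edges a a+b + edges b a          ≤⟨ +-monoʳ-≤ (edges a a+b) (edges-monoʳ b (λ v → m≤m+n (a v) (b v))) ⟩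
    edges a a+b + edges b a+b        ≡⟨ edges-+ˡ a b a+b ⟨
    edges a+b a+b                    ∎
    where
    open ≤-Reasoning
    a+b : Fin n → ℕ
    a+b v = a v + b v

-- The truncated k ∸ 1 makes the statement hold for the empty set as well.
forest-edges≤ : (G : Graph n) → Acyclic G → ∀ k (s : Fin n → ℕ) → (∀ v → s v ≤ 1) → sum s ≡ k →
                edges G s s ≤ 2 * (k ∸ 1)
forest-edges≤ {n} G acyclic zero s s≤1 Σs≡0 = begin
  edges G s s          ≤⟨ sum-mono (λ u → *-monoʳ-≤ (s u) (subst (deg G s u ≤_) Σs≡0 (deg≤sum G s u))) ⟩
  sum (λ u → s u * 0)  ≡⟨ sum-cong-≗ (λ u → *-zeroʳ (s u)) ⟩
  sum {n} (const 0)    ≡⟨ sum-replicate-zero n ⟩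
  0                    ∎
  where open ≤-Reasoning
forest-edges≤ {n} G acyclic (suc k) s s≤1 Σs≡1+k with any? (λ v → s v ≟ℕ 1)
... | no none = contradiction (trans (sym Σs≡1+k) Σs≡0) λ ()
  where
  s≡0 : ∀ v → s v ≡ 0
  s≡0 v = n<1⇒n≡0 (≤∧≢⇒< (s≤1 v) (λ e → none (v , e)))
  Σs≡0 : sum s ≡ 0
  Σs≡0 = trans (sum-cong-≗ s≡0) (sum-replicate-zero n)
-- Induction by deleting a leaf `v` of the forest induced by `s`; what remains is `t`, and at most
-- one edge is lost.
... | yes (r , sr≡1)
  with v , sv≡1 , p , only-p ← leaf-exists G acyclic (λ v → s v ≟ℕ 1) sr≡1 = begin
  edges G s s                  ≡⟨ edges-cong G s≗δ+t s≗δ+t ⟩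
  edges G δ+t δ+t              ≡⟨ edges-insert G v t ⟩
  -- For `k = 0` the deleted vertex was the last one and has no edge. The bound `1 ⊓ k` records this
  -- and makes up for the truncation in `k ∸ 1`.
  edges G t t + 2 * deg G t v  ≤⟨ +-mono-≤ (forest-edges≤ G acyclic k t t≤1 Σt≡k) (*-monoʳ-≤ 2 (⊓-glb deg≤1 deg≤k)) ⟩
  2 * (k ∸ 1) + 2 * (1 ⊓ k)    ≡⟨ *-distribˡ-+ 2 (k ∸ 1) (1 ⊓ k) ⟨
  2 * (k ∸ 1 + 1 ⊓ k)          ≡⟨ cong (2 *_) (trans (+-comm (k ∸ 1) (1 ⊓ k)) (m⊓n+n∸m≡n 1 k)) ⟩
  2 * k                        ∎
  where
  open ≤-Reasoning
  t δ+t : Fin n → ℕ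
  t w = s w ∸ δ v w
  δ+t w = δ v w + t w
  s≗δ+t : s ≗ δ+t
  s≗δ+t w = sym (m+[n∸m]≡n (δ≤ v (≤-reflexive (sym sv≡1)) w))
  t≤s : ∀ w → t w ≤ s w
  t≤s w = m∸n≤m (s w) (δ v w)
  t≤1 : ∀ w → t w ≤ 1
  t≤1 w = ≤-trans (t≤s w) (s≤1 w)
  Σt≡k : sum t ≡ k
  Σt≡k = suc-injective (begin-equality
    suc (sum t)        ≡⟨ cong (_+ sum t) (sum-δ≡1 v) ⟨
    sum (δ v) + sum t  ≡⟨ ∑-distrib-+ (δ v) t ⟨
    sum δ+t            ≡⟨ sum-cong-≗ s≗δ+t ⟨
    sum s              ≡⟨ Σs≡1+k ⟩
    suc k              ∎)
  deg≤k : deg G t v ≤ k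
  deg≤k = subst (deg G t v ≤_) Σt≡k (deg≤sum G t v)
  none-but-p : ∀ w → w ≢ p → adj G v w * s w ≡ 0
  none-but-p w w≢p with adj? G v w
  ... | no _   = refl
  ... | yes vw = trans (*-identityˡ (s w)) (n<1⇒n≡0 (≤∧≢⇒< (s≤1 w) (w≢p ∘ only-p w vw)))
  deg≤1 : deg G t v ≤ 1
  deg≤1 = begin
    deg G t v  ≤⟨ deg-mono G t≤s v ⟩
    deg G s v  ≤⟨ sum-mono (≤δ p (*-mono-≤ (adj≤1 G v p) (s≤1 p)) none-but-p) ⟩
    sum (δ p)  ≡⟨ sum-δ≡1 p ⟩
    1          ∎

-- Twice the inequality between edges and vertices of a forest, with the subtraction moved to the
-- other side; it is exact because the set is nonempty.
nonempty-forest : (G : Graph n) → Acyclic G → (s : Fin n → ℕ) → (∀ v → s v ≤ 1) → 1 ≤ sum s →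
                  edges G s s + 2 ≤ 2 * sum s
nonempty-forest G acyclic s s≤1 1≤Σ = begin
  edges G s s + 2          ≤⟨ +-monoˡ-≤ 2 (forest-edges≤ G acyclic (sum s) s s≤1 refl) ⟩
  2 * (sum s ∸ 1) + 2 * 1  ≡⟨ *-distribˡ-+ 2 (sum s ∸ 1) 1 ⟨
  2 * (sum s ∸ 1 + 1)      ≡⟨ cong (2 *_) (m∸n+n≡m 1≤Σ) ⟩
  2 * sum s                ∎
  where open ≤-Reasoning

-- Functions with a vertex of value 0

is0 is3 is23 : Fin 4 → ℕ
is0 0F = 1
is0 _  = 0
is3 3F = 1
is3 _  = 0
is23 2F = 1
is23 3F = 1
is23 _  = 0

-- How often a pair (u , v) with u in V₀ and v of value x counts in the sum of edges s s over
-- both forests: a pair in V₀ × V₀ once for each, a pair leaving V₀ also in reverse.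
multiplicity : Fin 4 → ℕ
multiplicity x = is0 x + is3 x + is3 x + (is0 x + is23 x + is23 x)

module _ (G : Graph n) {f : Fin n → Fin 4} (rdrd : IsRDRD G f) where
  open IsRDRD rdrd

  private
    value : Fin n → Fin n → ℕ
    value u v = adj G u v * multiplicity (f v)

    value-of : ∀ {u v x} → Adj G u v → f v ≡ x → value u v ≡ multiplicity x
    value-of uv refl = trans (cong (_* _) (adj-1 G uv)) (*-identityˡ _)

    distinct : ∀ {u v x y} → f u ≡ x → f v ≡ y → x ≢ y → u ≢ v
    distinct fu fv x≢y refl = x≢y (trans (sym fu) fv)

  -- The multiplicities of the values 0, 2 and 3 are 2, 2 and 4. A neighbour of value 0 gives 2, and
  -- the dominating neighbours give 2 + 2 or 4.
  zero-degree≥6 : ∀ u → f u ≡ 0F → 6 ≤ deg G (multiplicity ∘ f) u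
  zero-degree≥6 u fu with restrained u fu | zero-dominated u fu
  ... | z , uz , fz | inj₁ (x , y , x≢y , (ux , fx) , (uy , fy)) =
    ≤-trans (≤-reflexive (sym (cong₂ _+_ (value-of uz fz) (cong₂ _+_ (value-of ux fx) (cong (_+ 0) (value-of uy fy))))))
      (unique-sum≤ ((distinct fz fx (λ ()) ∷ distinct fz fy (λ ()) ∷ []) ∷ (x≢y ∷ []) ∷ [] ∷ []) (value u))
  ... | z , uz , fz | inj₂ (x , ux , fx) =
    ≤-trans (≤-reflexive (sym (cong₂ _+_ (value-of uz fz) (cong (_+ 0) (value-of ux fx)))))
      (unique-sum≤ ((distinct fz fx (λ ()) ∷ []) ∷ [] ∷ []) (value u))

  -- Double counting of the edges in V₀ ∪ V₃ (`s₁`) and in V₀ ∪ V₂ ∪ V₃ (`s₂`): `zero-degree≥6`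
  -- bounds their total from below, the forest bound from above. The goal is doubled and `6 * Z` is
  -- added to both sides, so that no subtraction occurs.
  weight-with-zero : Acyclic G → ∀ r → f r ≡ 0F → n + 2 ≤ weight f
  weight-with-zero acyclic r fr = *-cancelˡ-≤ 2 (+-cancelˡ-≤ (6 * Z) _ _ (begin
    6 * Z + 2 * (n + 2)                                     ≤⟨ +-monoˡ-≤ (2 * (n + 2)) 6Z≤ ⟩
    edges G s₁ s₁ + edges G s₂ s₂ + 2 * (n + 2)             ≡⟨ regroup (edges G s₁ s₁) (edges G s₂ s₂) n ⟩
    (edges G s₁ s₁ + 2) + (edges G s₂ s₂ + 2) + n * 2       ≤⟨ +-monoˡ-≤ (n * 2) (+-mono-≤
                                                                 (nonempty-forest G acyclic s₁ s₁≤1 (nonempty is3))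
                                                                 (nonempty-forest G acyclic s₂ s₂≤1 (nonempty is23))) ⟩
    2 * sum s₁ + 2 * sum s₂ + n * 2                         ≡⟨ totals ⟩
    6 * Z + 2 * weight f                                    ∎))
    where
    open ≤-Reasoning
    z s₁ s₂ : Fin n → ℕ
    z v = is0 (f v)
    s₁ v = z v + is3 (f v)
    s₂ v = z v + is23 (f v)
    Z : ℕ
    Z = sum z

    s₁≤1 : ∀ v → s₁ v ≤ 1
    s₁≤1 v with f v
    ... | 0F = ≤-refl
    ... | 1F = z≤n
    ... | 2F = z≤n
    ... | 3F = ≤-refl
    s₂≤1 : ∀ v → s₂ v ≤ 1
    s₂≤1 v with f v
    ... | 0F = ≤-refl
    ... | 1F = z≤n
    ... | 2F = ≤-refl
    ... | 3F = ≤-refl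

    nonempty : ∀ (b : Fin 4 → ℕ) → 1 ≤ sum (λ v → z v + b (f v))
    nonempty b = begin
      1                             ≡⟨ cong is0 fr ⟨
      z r                           ≤⟨ m≤m+n (z r) (b (f r)) ⟩
      z r + b (f r)                 ≡⟨ +-identityʳ _ ⟨
      z r + b (f r) + 0             ≤⟨ unique-sum≤ ([] ∷ []) (λ v → z v + b (f v)) ⟩
      sum (λ v → z v + b (f v))     ∎

    6z≤ : ∀ u → 6 * z u ≤ z u * deg G (multiplicity ∘ f) u
    6z≤ u with f u in fu
    ... | 0F = ≤-trans (zero-degree≥6 u fu) (≤-reflexive (sym (*-identityˡ _)))
    ... | 1F = z≤n
    ... | 2F = z≤n
    ... | 3F = z≤n

    6Z≤ : 6 * Z ≤ edges G s₁ s₁ + edges G s₂ s₂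
    6Z≤ = begin
      6 * Z                                    ≡⟨ *-distribˡ-sum 6 z ⟩
      sum (λ u → 6 * z u)                      ≤⟨ sum-mono 6z≤ ⟩
      -- By definition `multiplicity ∘ f` is the sum of the two functions to which `edges-sum-≥`
      -- applies, one for each forest.
      edges G z (multiplicity ∘ f)             ≡⟨ edges-+ʳ G z (λ v → s₁ v + is3 (f v)) (λ v → s₂ v + is23 (f v)) ⟩
      edges G z (λ v → s₁ v + is3 (f v)) + edges G z (λ v → s₂ v + is23 (f v))
                                               ≤⟨ +-mono-≤ (edges-sum-≥ G z (is3 ∘ f)) (edges-sum-≥ G z (is23 ∘ f)) ⟩
      edges G s₁ s₁ + edges G s₂ s₂            ∎

    regroup : ∀ a b n → a + b + 2 * (n + 2) ≡ (a + 2) + (b + 2) + n * 2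
    regroup = solve-∀

    -- The share of one vertex in `totals`; the summand 2 adds up to `n * 2`.
    pointwise : ∀ x → 2 * (is0 x + is3 x) + 2 * (is0 x + is23 x) + 2 ≡ 6 * is0 x + 2 * toℕ x
    pointwise 0F = refl
    pointwise 1F = refl
    pointwise 2F = refl
    pointwise 3F = refl

    totals : 2 * sum s₁ + 2 * sum s₂ + n * 2 ≡ 6 * Z + 2 * weight f
    totals = begin-equality
      2 * sum s₁ + 2 * sum s₂ + n * 2
        ≡⟨ cong₂ _+_ (cong₂ _+_ (*-distribˡ-sum 2 s₁) (*-distribˡ-sum 2 s₂)) (sym (sum-const n 2)) ⟩
      sum (λ v → 2 * s₁ v) + sum (λ v → 2 * s₂ v) + sum {n} (const 2)
        ≡⟨ cong (_+ sum {n} (const 2)) (∑-distrib-+ (λ v → 2 * s₁ v) (λ v → 2 * s₂ v)) ⟨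
      sum (λ v → 2 * s₁ v + 2 * s₂ v) + sum {n} (const 2)
        ≡⟨ ∑-distrib-+ (λ v → 2 * s₁ v + 2 * s₂ v) (const 2) ⟨
      sum (λ v → 2 * s₁ v + 2 * s₂ v + 2)
        ≡⟨ sum-cong-≗ (pointwise ∘ f) ⟩
      sum (λ v → 6 * z v + 2 * toℕ (f v))
        ≡⟨ ∑-distrib-+ (λ v → 6 * z v) (λ v → 2 * toℕ (f v)) ⟩
      sum (λ v → 6 * z v) + sum (λ v → 2 * toℕ (f v))
        ≡⟨ cong₂ _+_ (*-distribˡ-sum 6 z) (*-distribˡ-sum 2 (toℕ ∘ f)) ⟨
      6 * Z + 2 * weight f ∎

-- Functions without a vertex of value 0

-- Two adjacent vertices other than `c` would form a triangle with `c`, so every edge has `c` as one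
-- end.
star : ∀ {m} (T : Graph (suc m)) → Acyclic T → ∀ c → (∀ v → v ≢ c → Adj T v c) → T ≅ K 1 m
star {m} T acyclic c dominated = record { bijection = π ; preserves = λ u v → mk⇔ (to u v) (from u v) }
  where
  π : Permutation (suc m) (suc m)
  -- The part of size 1 in `K 1 m` is the vertex 0, so the centre has to move there.
  π = transpose c 0F
  module π = Inverse π

  centre : ∀ {u} → toℕ (π.to u) < 1 → u ≡ c
  centre {u} lt = trans (sym (π.strictlyInverseʳ u))
    (cong π.from (toℕ-injective {j = 0F} (n<1⇒n≡0 lt)))
  πc<1 : toℕ (π.to c) < 1
  πc<1 = subst (λ x → toℕ x < 1) (sym (π.strictlyInverseˡ 0F)) (s≤s z≤n)
  leaf : ∀ {u} → u ≢ c → 1 ≤ toℕ (π.to u)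
  leaf u≢c = ≮⇒≥ (u≢c ∘ centre)
  leaf⁻ : ∀ {u} → 1 ≤ toℕ (π.to u) → u ≢ c
  leaf⁻ 1≤u u≡c = <⇒≱ πc<1 (subst (λ x → 1 ≤ toℕ (π.to x)) u≡c 1≤u)

  one-end-is-centre : ∀ {u v} → Adj T u v → (u ≡ c × v ≢ c) ⊎ (u ≢ c × v ≡ c)
  one-end-is-centre {u} {v} uv with u ≟ c | v ≟ c
  ... | yes refl | yes refl = contradiction uv (irrefl T)
  ... | yes u≡c  | no v≢c   = inj₁ (u≡c , v≢c)
  ... | no u≢c   | yes v≡c  = inj₂ (u≢c , v≡c)
  ... | no u≢c   | no v≢c   = contradiction
    (s≤s (s≤s z≤n)
    , ((λ { refl → irrefl T uv }) ∷ u≢c ∷ []) ∷ (v≢c ∷ []) ∷ [] ∷ []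
    , uv ∷ dominated v v≢c ∷ symm T (dominated u u≢c) ∷ [-])
    (acyclic u (v ∷ c ∷ []))

  to : ∀ u v → Adj T u v → Adj (K 1 m) (π.to u) (π.to v)
  to u v uv with one-end-is-centre uv
  ... | inj₁ (refl , v≢c) = inj₁ (πc<1 , leaf v≢c)
  ... | inj₂ (u≢c , refl) = inj₂ (leaf u≢c , πc<1)

  from : ∀ u v → Adj (K 1 m) (π.to u) (π.to v) → Adj T u v
  from u v (inj₁ (u<1 , 1≤v)) =
    subst (λ x → Adj T x v) (sym (centre u<1)) (symm T (dominated v (leaf⁻ 1≤v)))
  from u v (inj₂ (1≤u , v<1)) =
    subst (Adj T u) (sym (centre v<1)) (dominated u (leaf⁻ 1≤u))

weight-excess : (f : Fin n → Fin 4) → (∀ v → f v ≢ 0F) → weight f ≡ n + sum (λ v → toℕ (f v) ∸ 1)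
weight-excess {n} f f≢0 = begin
  weight f                                       ≡⟨ sum-cong-≗ split ⟩
  sum (λ v → 1 + (toℕ (f v) ∸ 1))                ≡⟨ ∑-distrib-+ (const 1) (λ v → toℕ (f v) ∸ 1) ⟩
  sum {n} (const 1) + sum (λ v → toℕ (f v) ∸ 1)  ≡⟨ cong (_+ sum (λ v → toℕ (f v) ∸ 1)) (trans (sum-const n 1) (*-identityʳ n)) ⟩
  n + sum (λ v → toℕ (f v) ∸ 1)                  ∎
  where
  open ≡-Reasoning
  split : ∀ v → toℕ (f v) ≡ 1 + (toℕ (f v) ∸ 1)
  split v with f v in fv
  ... | 0F    = contradiction fv (f≢0 v)
  ... | suc _ = refl

module _ {m} (T : Graph (suc m)) {f : Fin (suc m) → Fin 4} (rdrd : IsRDRD T f)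
         (f≢0 : ∀ v → f v ≢ 0F) where
  open IsRDRD rdrd

  Big : Fin (suc m) → Set
  Big v = f v ≡ 2F ⊎ f v ≡ 3F

  big? : Decidable Big
  big? v = (f v ≟ 2F) ⊎-dec (f v ≟ 3F)

  small : ∀ {v} → ¬ Big v → f v ≡ 1F
  small {v} ¬big with f v in fv
  ... | 0F = contradiction fv (f≢0 v)
  ... | 1F = refl
  ... | 2F = contradiction (inj₁ refl) ¬big
  ... | 3F = contradiction (inj₂ refl) ¬big

  big-exists : ∃[ c ] Big c
  big-exists with big? 0F
  ... | yes big = 0F , big
  ... | no ¬big with one-dominated 0F (small ¬big)
  ...   | c , _ , big = c , big

  excess : Fin (suc m) → ℕ
  excess v = toℕ (f v) ∸ 1

  big-excess : ∀ {v} → Big v → 1 ≤ excess v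
  big-excess (inj₁ e) rewrite e = ≤-refl
  big-excess (inj₂ e) rewrite e = s≤s z≤n

  weight≥ : 2 ≤ sum excess → suc m + 2 ≤ weight f
  weight≥ 2≤ = ≤-trans (+-monoʳ-≤ (suc m) 2≤) (≤-reflexive (sym (weight-excess f f≢0)))

  weight-without-zero : Acyclic T → ¬ (T ≅ K 1 m) → suc m + 2 ≤ weight f
  weight-without-zero acyclic ¬star with big-exists
  -- A vertex of value 3 has excess 2 by itself.
  ... | c , inj₂ fc = weight≥ (≤-trans (≤-reflexive (sym (cong (λ x → toℕ x ∸ 1 + 0) fc)))
                                       (unique-sum≤ ([] ∷ []) excess))
  ... | c , inj₁ fc with any? (λ v → ¬? (v ≟ c) ×-dec big? v)
  -- Two distinct big vertices contribute at least 1 each.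
  ...   | yes (d , d≢c , big) = weight≥ (≤-trans
            (+-mono-≤ (big-excess big) (+-mono-≤ (big-excess (inj₁ fc)) z≤n))
            (unique-sum≤ ((d≢c ∷ []) ∷ [] ∷ []) excess))
  ...   | no none = contradiction (star T acyclic c dominated) ¬star
    where
    -- Every vertex other than `c` has value 1 here, and the big neighbour that it needs can only be
    -- `c`.
    dominated : ∀ v → v ≢ c → Adj T v c
    dominated v v≢c with one-dominated v (small (λ big → none (v , v≢c , big)))
    ... | u , vu , big with u ≟ c
    ...   | yes refl = vu
    ...   | no u≢c   = contradiction (u , u≢c , big) none

theorem3p1 : (n : ℕ) → 2 ≤ n → (T : Graph n) → IsTree T →
    ¬ (T ≅ K 1 (n ∸ 1)) → n + 2 ≤ γrdR T
-- Since the minimum is attained, it suffices to bound the weight of one optimal function.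
theorem3p1 (suc m) _ T (_ , acyclic) ¬star with γrdR-attained T
... | f , rdrd , w≡γ = subst (suc m + 2 ≤_) w≡γ bound
  where
  bound : suc m + 2 ≤ weight f
  bound with any? (λ v → f v ≟ 0F)
  ... | yes (r , fr) = weight-with-zero T rdrd acyclic r fr
  ... | no none      = weight-without-zero T rdrd (λ v fv → none (v , fv)) acyclic ¬star
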